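{- Let $n$ be a positive integer, let $D$ be the incidence matrix of a finite affine plane of order $n$, let $m=n^2+n$, and let $\vec{s}=(\tfrac1{n^2},\tfrac1{n^2},\dots,\tfrac1{n^2})^T\in\mathbb{R}^{n^2}$. Then $(D,\vec{s})$ is an ATAC data distribution on $m$ machines with minimal data storage limit, i.e. $L(D,\vec{s})=L_{\min}(m)$.
   Context: A data distribution on $m$ machines is a pair $(D,\vec{s})$, where, for some positive integer $x$ (the number of data groups, not fixed in advance), $D=(d_{ij})$ is an $m\times x$ matrix with entries in $\{0,1\}$ ($d_{ij}=1$ iff data group $j$ is stored on machine $i$), and $\vec{s}\in\mathbb{R}^x$ is a column vector with non-negative entries summing to $1$ ($s_j$ is the fraction of all data lying in data group $j$). It is an ATAC (All-to-All Comparison) data distribution if every entry of $D^TD$ is nonzero, i.e. for every pair of data groups (including a group paired with itself) some machine holds both. The data storage limit of $(D,\vec{s})$ is $L(D,\vec{s})=\max_{1\le i\le m}(D\vec{s})_i$. The minimal data storage limit $L_{\min}(m)$ is the minimum of $L(D,\vec{s})$ over all ATAC data distributions on $m$ machines (over all $x$). A finite affine plane of order $n$ is a set of $n^2$ points and $n^2+n$ lines with an incidence relation such that: every pair of distinct points has exactly one line passing through both; every line contains $n$ points; every point is on $n+1$ lines. Its incidence matrix has rows indexed by lines and columns indexed by points, with entry $1$ if the line contains the point and $0$ otherwise. -}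

module Defs where

open import Level using (0ℓ)
open import Algebra.Bundles.Raw using (RawMonoid)
import Algebra.Definitions.RawMonoid as RawMonoidDefs
open import Data.Bool.Base using (if_then_else_)
open import Data.Fin.Base using (Fin; zero; suc; toℕ)
open import Data.Integer.Base using (+_)
open import Data.Nat.Base as ℕ using (ℕ; suc; NonZero)
import Data.Nat.Properties as ℕ
open import Data.Product.Base using (∃-syntax; Σ-syntax; _×_; _,_)
open import Data.Product using (∃!)
open import Data.Rational.Base as ℚ using (ℚ; 0ℚ; 1ℚ; ½; ∣_∣)
import Data.Rational.Properties as ℚ
open import Data.Rational.Solver using (module +-*-Solver)
open import Data.Sum.Base using (inj₁; inj₂)
open import Data.Vec.Base using (count; allFin)
open import Data.Vec.Functional using (Vector; foldr; head; tail; transpose)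
open import Relation.Binary.Core using (REL)
open import Relation.Binary.Definitions using (Decidable)
open import Relation.Binary.PropositionalEquality
  using (_≡_; _≢_; refl; sym; trans; cong; subst; subst₂)
open import Relation.Nullary.Decidable using (does)

------------------------------------------------------------------------
-- Real numbers

-- Cauchy sequences of rationals; _≈_ below is the equality of the reals they
-- represent.  The existential carries a modulus of convergence, and all
-- operations are pointwise.

IsCauchy : (ℕ → ℚ) → Set
IsCauchy f = ∀ ε → 0ℚ ℚ.< ε →
  ∃[ N ] (∀ i j → N ℕ.≤ i → N ℕ.≤ j → ∣ f i ℚ.- f j ∣ ℚ.< ε)

record ℝ : Set where
  constructor mkℝ
  field
    seq    : ℕ → ℚ
    cauchy : IsCauchy seq

open ℝ public

infix 4 _≈_ _≤_

record _≈_ (x y : ℝ) : Set where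
  constructor mk≈
  field
    close : ∀ ε → 0ℚ ℚ.< ε →
      ∃[ N ] (∀ i → N ℕ.≤ i → ∣ seq x i ℚ.- seq y i ∣ ℚ.< ε)

-- The slack ε is essential: 0 ≤ lim (- 1/(i+1)), although no term of the
-- sequence is non-negative.
record _≤_ (x y : ℝ) : Set where
  constructor mk≤
  field
    below : ∀ ε → 0ℚ ℚ.< ε →
      ∃[ N ] (∀ i → N ℕ.≤ i → seq x i ℚ.< seq y i ℚ.+ ε)

-- Abstract only so that the moduli are never unfolded during type checking.
abstract
  const-cauchy : ∀ q → IsCauchy (λ _ → q)
  const-cauchy q ε 0<ε =
    0 , λ _ _ _ _ → subst (ℚ._< ε) (sym (cong ∣_∣ (ℚ.+-inverseʳ q))) 0<ε

  0<½* : ∀ {ε} → 0ℚ ℚ.< ε → 0ℚ ℚ.< ½ ℚ.* ε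
  0<½* {ε} 0<ε = subst (ℚ._< ½ ℚ.* ε) (ℚ.*-zeroʳ ½) (ℚ.*-monoʳ-<-pos ½ 0<ε)

  ½*+½* : ∀ ε → ½ ℚ.* ε ℚ.+ ½ ℚ.* ε ≡ ε
  ½*+½* ε = trans (sym (ℚ.*-distribʳ-+ ε ½ ½)) (ℚ.*-identityˡ ε)

  +-cauchy : ∀ f g → IsCauchy f → IsCauchy g → IsCauchy (λ i → f i ℚ.+ g i)
  +-cauchy f g F G ε 0<ε with F (½ ℚ.* ε) (0<½* 0<ε) | G (½ ℚ.* ε) (0<½* 0<ε)
  ... | M , FM | N , GN = M ℕ.⊔ N , λ i j M⊔N≤i M⊔N≤j →
    subst₂ ℚ._<_
      (cong ∣_∣ (rearrange (f i) (g i) (f j) (g j)))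
      (½*+½* ε)
      (ℚ.≤-<-trans (ℚ.∣p+q∣≤∣p∣+∣q∣ (f i ℚ.- f j) (g i ℚ.- g j))
        (ℚ.+-mono-<
          (FM i j (ℕ.m⊔n≤o⇒m≤o M N M⊔N≤i) (ℕ.m⊔n≤o⇒m≤o M N M⊔N≤j))
          (GN i j (ℕ.m⊔n≤o⇒n≤o M N M⊔N≤i) (ℕ.m⊔n≤o⇒n≤o M N M⊔N≤j))))
    where
    open +-*-Solver
    rearrange : ∀ a b c d →
      (a ℚ.- c) ℚ.+ (b ℚ.- d) ≡ (a ℚ.+ b) ℚ.- (c ℚ.+ d)
    rearrange = solve 4
      (λ a b c d → (a :- c) :+ (b :- d) := (a :+ b) :- (c :+ d)) refl

  module _ (a b : ℚ) {ε : ℚ} where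
    open +-*-Solver

    ∣-∣<⇒<+ : ∣ a ℚ.- b ∣ ℚ.< ε → a ℚ.< b ℚ.+ ε
    ∣-∣<⇒<+ d = subst (ℚ._< b ℚ.+ ε)
      (solve 2 (λ a b → b :+ (a :- b) := a) refl a b)
      (ℚ.+-monoʳ-< b (ℚ.≤-<-trans p≤∣p∣ d))
      where
      p≤∣p∣ : a ℚ.- b ℚ.≤ ∣ a ℚ.- b ∣
      p≤∣p∣ with ℚ.≤-total 0ℚ (a ℚ.- b)
      ... | inj₁ 0≤p = ℚ.≤-reflexive (sym (ℚ.0≤p⇒∣p∣≡p 0≤p))
      ... | inj₂ p≤0 = ℚ.≤-trans p≤0 (ℚ.0≤∣p∣ (a ℚ.- b))

    <+⇒∣-∣< : a ℚ.< b ℚ.+ ε → b ℚ.< a ℚ.+ ε → ∣ a ℚ.- b ∣ ℚ.< ε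
    <+⇒∣-∣< a<b+ε b<a+ε with ℚ.∣p∣≡p∨∣p∣≡-p (a ℚ.- b)
    ... | inj₁ eq = subst₂ ℚ._<_ (sym eq)
      (solve 2 (λ b ε → (b :+ ε) :- b := ε) refl b ε)
      (ℚ.+-monoˡ-< (ℚ.- b) a<b+ε)
    ... | inj₂ eq = subst₂ ℚ._<_
      (trans (solve 2 (λ a b → b :- a := :- (a :- b)) refl a b) (sym eq))
      (solve 2 (λ a ε → (a :+ ε) :- a := ε) refl a ε)
      (ℚ.+-monoˡ-< (ℚ.- a) b<a+ε)

  ⊔-<+ : ∀ a b c d {ε} → a ℚ.< c ℚ.+ ε → b ℚ.< d ℚ.+ ε →
         a ℚ.⊔ b ℚ.< (c ℚ.⊔ d) ℚ.+ ε
  ⊔-<+ a b c d {ε} a<c+ε b<d+ε with ℚ.⊔-sel a b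
  ... | inj₁ eq = subst (ℚ._< (c ℚ.⊔ d) ℚ.+ ε) (sym eq)
    (ℚ.<-≤-trans a<c+ε (ℚ.+-monoˡ-≤ ε (ℚ.p≤p⊔q c d)))
  ... | inj₂ eq = subst (ℚ._< (c ℚ.⊔ d) ℚ.+ ε) (sym eq)
    (ℚ.<-≤-trans b<d+ε (ℚ.+-monoˡ-≤ ε (ℚ.p≤q⊔p c d)))

  ⊔-cauchy : ∀ f g → IsCauchy f → IsCauchy g → IsCauchy (λ i → f i ℚ.⊔ g i)
  ⊔-cauchy f g F G ε 0<ε with F ε 0<ε | G ε 0<ε
  ... | M , FM | N , GN = M ℕ.⊔ N , λ i j p q →
      <+⇒∣-∣< (f i ℚ.⊔ g i) (f j ℚ.⊔ g j) (bound i j p q) (bound j i q p)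
    where
    bound : ∀ i j → M ℕ.⊔ N ℕ.≤ i → M ℕ.⊔ N ℕ.≤ j →
            f i ℚ.⊔ g i ℚ.< (f j ℚ.⊔ g j) ℚ.+ ε
    bound i j p q = ⊔-<+ (f i) (g i) (f j) (g j)
      (∣-∣<⇒<+ (f i) (f j) (FM i j (ℕ.m⊔n≤o⇒m≤o M N p) (ℕ.m⊔n≤o⇒m≤o M N q)))
      (∣-∣<⇒<+ (g i) (g j) (GN i j (ℕ.m⊔n≤o⇒n≤o M N p) (ℕ.m⊔n≤o⇒n≤o M N q)))

fromℚ : ℚ → ℝ
fromℚ q = mkℝ (λ _ → q) (const-cauchy q)

0ℝ 1ℝ : ℝ
0ℝ = fromℚ 0ℚ
1ℝ = fromℚ 1ℚ

infixl 6 _+_ _⊔_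

_+_ : ℝ → ℝ → ℝ
x + y = mkℝ (λ i → seq x i ℚ.+ seq y i) (+-cauchy (seq x) (seq y) (cauchy x) (cauchy y))

_⊔_ : ℝ → ℝ → ℝ
x ⊔ y = mkℝ (λ i → seq x i ℚ.⊔ seq y i) (⊔-cauchy (seq x) (seq y) (cauchy x) (cauchy y))

+-0-rawMonoid : RawMonoid 0ℓ 0ℓ
+-0-rawMonoid = record { Carrier = ℝ ; _≈_ = _≈_ ; _∙_ = _+_ ; ε = 0ℝ }

-- k · x is the k-fold sum x + … + x; a real product by a natural number is
-- all that a 0/1 matrix acting on a real vector needs.
open RawMonoidDefs +-0-rawMonoid public using (sum) renaming (_×_ to _·_)

maximum : ∀ {m} .{{_ : NonZero m}} → Vector ℝ m → ℝ
maximum {suc m} v = foldr _⊔_ (head v) (tail v)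

------------------------------------------------------------------------
-- Data distributions

open RawMonoidDefs ℕ.+-0-rawMonoid public using () renaming (sum to sumℕ)

-- 0/1 matrices, as vectors of rows.
BinaryMatrix : ℕ → ℕ → Set
BinaryMatrix m x = Vector (Vector (Fin 2) x) m

-- DᵀE, with entries in ℕ.
_ᵀ*_ : ∀ {m x y} → BinaryMatrix m x → BinaryMatrix m y → Vector (Vector ℕ y) x
(D ᵀ* E) j k = sumℕ (λ i → toℕ (transpose D j i) ℕ.* toℕ (E i k))

_*ᵥ_ : ∀ {m x} → BinaryMatrix m x → Vector ℝ x → Vector ℝ m
(D *ᵥ s) i = sum (λ j → toℕ (D i j) · s j)

record IsDataDistribution {m x} (D : BinaryMatrix m x) (s : Vector ℝ x) : Set where
  field
    groups-nonZero : NonZero x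
    s-nonNegative  : ∀ j → 0ℝ ≤ s j
    s-total        : sum s ≈ 1ℝ

record IsATAC {m x} (D : BinaryMatrix m x) (s : Vector ℝ x) : Set where
  field
    isDataDistribution : IsDataDistribution D s
    allToAll           : ∀ j k → (D ᵀ* D) j k ≢ 0

storageLimit : ∀ {m x} .{{_ : NonZero m}} → BinaryMatrix m x → Vector ℝ x → ℝ
storageLimit D s = maximum (D *ᵥ s)

-- v is the real number L_min(m): a minimum is an attained lower bound.
record IsMinimalStorageLimit (m : ℕ) .{{_ : NonZero m}} (v : ℝ) : Set where
  field
    attained   : ∃[ x ] Σ[ D ∈ BinaryMatrix m x ] Σ[ s ∈ Vector ℝ x ]
                   (IsATAC D s × storageLimit D s ≈ v)
    lowerBound : ∀ {x} (D : BinaryMatrix m x) (s : Vector ℝ x) →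
                   IsATAC D s → v ≤ storageLimit D s

------------------------------------------------------------------------
-- Finite affine planes

-- The points and the lines come enumerated, which is what makes the incidence
-- matrix well defined.  Lines are not identified with their sets of points:
-- in the plane of order 1 two lines pass through the only point.
Point Line : ℕ → Set
Point n = Fin (n ℕ.* n)
Line  n = Fin (n ℕ.* n ℕ.+ n)

record AffinePlane (n : ℕ) : Set₁ where
  field
    _∋_  : REL (Line n) (Point n) 0ℓ
    _∋?_ : Decidable _∋_
    unique-line     : ∀ p q → p ≢ q → ∃! _≡_ (λ l → l ∋ p × l ∋ q)
    points-per-line : ∀ l → count (λ p → l ∋? p) (allFin (n ℕ.* n)) ≡ n
    lines-per-point : ∀ p → count (λ l → l ∋? p) (allFin (n ℕ.* n ℕ.+ n)) ≡ suc n

incidenceMatrix : ∀ {n} → AffinePlane n → BinaryMatrix (n ℕ.* n ℕ.+ n) (n ℕ.* n)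
incidenceMatrix P l p = if does (l ∋? p) then suc zero else zero
  where open AffinePlane P

module _ (n : ℕ) .{{_ : NonZero n}} where

  n*n≢0 : NonZero (n ℕ.* n)
  n*n≢0 = ℕ.m*n≢0 n n

  n*n+n≢0 : NonZero (n ℕ.* n ℕ.+ n)
  n*n+n≢0 = ℕ.>-nonZero (ℕ.≤-trans (ℕ.>-nonZero⁻¹ n) (ℕ.m≤n+m n (n ℕ.* n)))

  1/n² : ℝ
  1/n² = fromℚ (ℚ._/_ (+ 1) (n ℕ.* n) {{n*n≢0}})

{-# OPTIONS --safe #-}

-- Let L be the storage limit of an ATAC data distribution (D , s) on n² + n
-- machines.  If some data group j is stored on at most n machines, then these
-- machines together hold every data group, so 1 ≤ n · L.  Otherwise every data
-- group is stored on at least n + 1 machines, so counting over all machines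
-- n + 1 ≤ (n² + n) · L.  Either way 1/n ≤ L, and 1/n is the share n · (1/n²) of
-- the data held by each machine of the affine plane.  Both estimates sum the
-- loads of the machines with weights in ℕ (the column j, or all ones), so only
-- the ordered additive monoid of ℝ is involved.

module Submission where

open import Defs
open import Level using (0ℓ)
open import Algebra.Bundles using (CommutativeMonoid)
import Algebra.Properties.CommutativeMonoid.Mult as Mult
import Algebra.Properties.CommutativeMonoid.Sum as Sum
open import Data.Bool.Base using (true; false; if_then_else_)
open import Data.Fin.Base using (Fin; zero; suc; toℕ)
open import Data.Fin.Properties using (any?; _≟_)
open import Data.Integer.Base using (+_)
import Data.Integer.Properties as ℤ
open import Data.Integer.Solver using () renaming (module +-*-Solver to ℤ-Solver)
open import Data.Nat.Base as ℕ using (ℕ; zero; suc; NonZero; z≤n; s≤s)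
import Data.Nat.Properties as ℕ
open import Data.Nat.Tactic.RingSolver using (solve-∀)
open import Data.Product.Base using (_×_; _,_; proj₁; proj₂)
open import Data.Rational.Base as ℚ using (0ℚ; ½; toℚᵘ)
import Data.Rational.Properties as ℚ
open import Data.Rational.Solver using (module +-*-Solver)
open import Data.Rational.Unnormalised.Base using (mkℚᵘ; *≡*; _≃_)
import Data.Rational.Unnormalised.Properties as ℚᵘ
open import Data.Vec.Base using (count; tabulate)
open import Data.Vec.Functional using (Vector; foldr; head; replicate; tail)
open import Relation.Binary.Bundles using (Poset)
open import Relation.Binary.PropositionalEquality
  using (_≡_; _≢_; refl; sym; trans; cong; cong₂; subst; subst₂)
import Relation.Binary.Reasoning.PartialOrder as PosetReasoning
open import Relation.Nullary.Decidable using (yes; no; does; dec-true)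
open import Relation.Nullary.Negation using (contradiction)
open import Relation.Unary using (Pred; Decidable)

open Mult ℚ.+-0-commutativeMonoid using ()
  renaming (_×_ to infixr 8 _×ℚ_; ×-distrib-+ to ×ℚ-distrib-+)
module Sumℕ = Sum ℕ.+-0-commutativeMonoid

-- The ordered additive monoid of real numbers

≈⇒≤ : ∀ {x y} → x ≈ y → x ≤ y
≈⇒≤ {x} {y} (mk≈ close) = mk≤ λ ε 0<ε → let N , d = close ε 0<ε in
  N , λ i N≤i → ∣-∣<⇒<+ (seq x i) (seq y i) (d i N≤i)

≤-antisym : ∀ {x y} → x ≤ y → y ≤ x → x ≈ y
≤-antisym {x} {y} (mk≤ p) (mk≤ q) = mk≈ λ ε 0<ε →
  let M , f = p ε 0<ε
      N , g = q ε 0<ε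
  in M ℕ.⊔ N , λ i M⊔N≤i → <+⇒∣-∣< (seq x i) (seq y i)
       (f i (ℕ.m⊔n≤o⇒m≤o M N M⊔N≤i)) (g i (ℕ.m⊔n≤o⇒n≤o M N M⊔N≤i))

≤-trans : ∀ {x y z} → x ≤ y → y ≤ z → x ≤ z
≤-trans {x} {y} {z} (mk≤ p) (mk≤ q) = mk≤ λ ε 0<ε →
  let M , f = p (½ ℚ.* ε) (0<½* 0<ε)
      N , g = q (½ ℚ.* ε) (0<½* 0<ε)
  in M ℕ.⊔ N , λ i M⊔N≤i →
    subst (seq x i ℚ.<_)
      (trans (ℚ.+-assoc (seq z i) (½ ℚ.* ε) (½ ℚ.* ε)) (cong (seq z i ℚ.+_) (½*+½* ε)))
      (ℚ.<-trans (f i (ℕ.m⊔n≤o⇒m≤o M N M⊔N≤i))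
        (ℚ.+-monoˡ-< (½ ℚ.* ε) (g i (ℕ.m⊔n≤o⇒n≤o M N M⊔N≤i))))

+-mono-≤ : ∀ {x y u v} → x ≤ y → u ≤ v → x + u ≤ y + v
+-mono-≤ {x} {y} {u} {v} (mk≤ p) (mk≤ q) = mk≤ λ ε 0<ε →
  let M , f = p (½ ℚ.* ε) (0<½* 0<ε)
      N , g = q (½ ℚ.* ε) (0<½* 0<ε)
  in M ℕ.⊔ N , λ i M⊔N≤i →
    subst (seq x i ℚ.+ seq u i ℚ.<_)
      (trans (interchange (seq y i) (½ ℚ.* ε) (seq v i) (½ ℚ.* ε))
        (cong (seq y i ℚ.+ seq v i ℚ.+_) (½*+½* ε)))
      (ℚ.+-mono-< (f i (ℕ.m⊔n≤o⇒m≤o M N M⊔N≤i)) (g i (ℕ.m⊔n≤o⇒n≤o M N M⊔N≤i)))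
  where
  open +-*-Solver
  interchange : ∀ a b c d → (a ℚ.+ b) ℚ.+ (c ℚ.+ d) ≡ (a ℚ.+ c) ℚ.+ (b ℚ.+ d)
  interchange = solve 4 (λ a b c d → (a :+ b) :+ (c :+ d) := (a :+ c) :+ (b :+ d)) refl

pointwise-≤ : ∀ {x y} → (∀ i → seq x i ℚ.≤ seq y i) → x ≤ y
pointwise-≤ {x} {y} p = mk≤ λ ε 0<ε → 0 , λ i _ →
  subst (ℚ._< seq y i ℚ.+ ε) (ℚ.+-identityʳ (seq x i)) (ℚ.+-mono-≤-< (p i) 0<ε)

pointwise-≈ : ∀ {x y} → (∀ i → seq x i ≡ seq y i) → x ≈ y
pointwise-≈ p = ≤-antisym
  (pointwise-≤ λ i → ℚ.≤-reflexive (p i))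
  (pointwise-≤ λ i → ℚ.≤-reflexive (sym (p i)))

≈-refl : ∀ {x} → x ≈ x
≈-refl = pointwise-≈ λ _ → refl

≈-sym : ∀ {x y} → x ≈ y → y ≈ x
≈-sym {x} {y} (mk≈ close) = mk≈ λ ε 0<ε → let N , d = close ε 0<ε in
  N , λ i N≤i → subst (ℚ._< ε) (∣p-q∣≡∣q-p∣ (seq x i) (seq y i)) (d i N≤i)
  where
  open +-*-Solver
  ∣p-q∣≡∣q-p∣ : ∀ p q → ℚ.∣ p ℚ.- q ∣ ≡ ℚ.∣ q ℚ.- p ∣
  ∣p-q∣≡∣q-p∣ p q = trans (sym (ℚ.∣-p∣≡∣p∣ (p ℚ.- q)))
    (cong ℚ.∣_∣ (solve 2 (λ p q → :- (p :- q) := q :- p) refl p q))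

≈-trans : ∀ {x y z} → x ≈ y → y ≈ z → x ≈ z
≈-trans p q = ≤-antisym
  (≤-trans (≈⇒≤ p) (≈⇒≤ q))
  (≤-trans (≈⇒≤ (≈-sym q)) (≈⇒≤ (≈-sym p)))

≤-poset : Poset 0ℓ 0ℓ 0ℓ
≤-poset = record
  { Carrier = ℝ
  ; _≈_ = _≈_
  ; _≤_ = _≤_
  ; isPartialOrder = record
    { isPreorder = record
      { isEquivalence = record { refl = ≈-refl ; sym = ≈-sym ; trans = ≈-trans }
      ; reflexive = ≈⇒≤
      ; trans = ≤-trans
      }
    ; antisym = ≤-antisym
    }
  }

open Poset ≤-poset using () renaming (refl to ≤-refl)

-- The raw monoid of this bundle is the one behind `sum` and `_·_`, so the general theory of sums
-- and multiples in commutative monoids applies to them directly.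
+-0-commutativeMonoid : CommutativeMonoid 0ℓ 0ℓ
+-0-commutativeMonoid = record
  { Carrier = ℝ
  ; _≈_ = _≈_
  ; _∙_ = _+_
  ; ε = 0ℝ
  ; isCommutativeMonoid = record
    { isMonoid = record
      { isSemigroup = record
        { isMagma = record
          { isEquivalence = record { refl = ≈-refl ; sym = ≈-sym ; trans = ≈-trans }
          ; ∙-cong = λ p q → ≤-antisym
              (+-mono-≤ (≈⇒≤ p) (≈⇒≤ q))
              (+-mono-≤ (≈⇒≤ (≈-sym p)) (≈⇒≤ (≈-sym q)))
          }
        ; assoc = λ x y z → pointwise-≈ λ i → ℚ.+-assoc (seq x i) (seq y i) (seq z i)
        }
      ; identity = (λ x → pointwise-≈ λ i → ℚ.+-identityˡ (seq x i))
                 , (λ x → pointwise-≈ λ i → ℚ.+-identityʳ (seq x i))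
      }
    ; comm = λ x y → pointwise-≈ λ i → ℚ.+-comm (seq x i) (seq y i)
    }
  }

open CommutativeMonoid +-0-commutativeMonoid using ()
  renaming (∙-congˡ to +-congˡ; identityʳ to +-identityʳ)
open Mult +-0-commutativeMonoid using ()
  renaming
  ( ×-congˡ to ·-congˡ; ×-congʳ to ·-congʳ; ×-assocˡ to ·-assocˡ
  ; ×-homo-+ to ·-homo-+; ×-homo-1 to ·-homo-1
  )
open Sum +-0-commutativeMonoid using (sum-cong-≋; sum-replicate; ∑-comm)
open PosetReasoning ≤-poset

-- Natural multiples

·-monoʳ-≤ : ∀ k {x y} → x ≤ y → k · x ≤ k · y
·-monoʳ-≤ zero    x≤y = ≤-refl
·-monoʳ-≤ (suc k) x≤y = +-mono-≤ x≤y (·-monoʳ-≤ k x≤y)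

·-nonNegative : ∀ k {x} → 0ℝ ≤ x → 0ℝ ≤ k · x
·-nonNegative zero    0≤x = ≤-refl
·-nonNegative (suc k) 0≤x =
  ≤-trans (≈⇒≤ (≈-sym (+-identityʳ 0ℝ))) (+-mono-≤ 0≤x (·-nonNegative k 0≤x))

·-monoˡ-≤ : ∀ {k l x} → 0ℝ ≤ x → k ℕ.≤ l → k · x ≤ l · x
·-monoˡ-≤ {l = l} 0≤x z≤n = ·-nonNegative l 0≤x
·-monoˡ-≤ 0≤x (s≤s k≤l)   = +-mono-≤ ≤-refl (·-monoˡ-≤ 0≤x k≤l)

seq-· : ∀ k x i → seq (k · x) i ≡ k ×ℚ seq x i
seq-· zero    x i = refl
seq-· (suc k) x i = cong (seq x i ℚ.+_) (seq-· k x i)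

×ℚ-monoʳ-≤ : ∀ k {p q} → p ℚ.≤ q → k ×ℚ p ℚ.≤ k ×ℚ q
×ℚ-monoʳ-≤ zero    p≤q = ℚ.≤-refl
×ℚ-monoʳ-≤ (suc k) p≤q = ℚ.+-mono-≤ p≤q (×ℚ-monoʳ-≤ k p≤q)

-- The order on ℚ is total, so this is the contrapositive of `×ℚ-monoʳ-≤`.
×ℚ-cancelˡ-< : ∀ k {p q} → k ×ℚ p ℚ.< k ×ℚ q → p ℚ.< q
×ℚ-cancelˡ-< k kp<kq = ℚ.≰⇒> λ q≤p →
  ℚ.<-irrefl refl (ℚ.<-≤-trans kp<kq (×ℚ-monoʳ-≤ k q≤p))

×ℚ-positive : ∀ k .{{_ : NonZero k}} {p} → 0ℚ ℚ.< p → 0ℚ ℚ.< k ×ℚ p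
×ℚ-positive 1             0<p = ℚ.+-mono-<-≤ 0<p ℚ.≤-refl
×ℚ-positive (suc (suc k)) 0<p = ℚ.+-mono-< 0<p (×ℚ-positive (suc k) 0<p)

-- The slack absorbs the factor: for a target slack ε the hypothesis is taken at `k ×ℚ ε`, and k
-- then cancels term by term in ℚ.
·-cancelˡ-≤ : ∀ k .{{_ : NonZero k}} {x y} → k · x ≤ k · y → x ≤ y
·-cancelˡ-≤ k {x} {y} (mk≤ below) = mk≤ λ ε 0<ε →
  let N , f = below (k ×ℚ ε) (×ℚ-positive k 0<ε)
  in N , λ i N≤i → ×ℚ-cancelˡ-< k (subst₂ ℚ._<_
       (seq-· k x i)
       (trans (cong (ℚ._+ k ×ℚ ε) (seq-· k y i)) (sym (×ℚ-distrib-+ (seq y i) ε k)))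
       (f i N≤i))

-- Unnormalised fractions keep gcds out of the induction; each step is an integer identity between
-- cross products.
×1/≃ : ∀ k d → toℚᵘ (k ×ℚ (+ 1 ℚ./ suc d)) ≃ mkℚᵘ (+ k) d
×1/≃ zero    d = *≡* refl
×1/≃ (suc k) d = ℚᵘ.≃-trans (ℚ.toℚᵘ-homo-+ (+ 1 ℚ./ suc d) (k ×ℚ (+ 1 ℚ./ suc d)))
  (ℚᵘ.≃-trans (ℚᵘ.+-cong (ℚ.toℚᵘ-fromℚᵘ (mkℚᵘ (+ 1) d)) (×1/≃ k d))
    (*≡* (solve 2 (λ k D → (con (+ 1) :* D :+ k :* D) :* D := (con (+ 1) :+ k) :* (D :* D))
      refl (+ k) (+ suc d))))
  where open ℤ-Solver

n²·1/n²≈1 : ∀ n .{{_ : NonZero n}} → (n ℕ.* n) · 1/n² n ≈ 1ℝ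
-- Matching on the successor lets `n ℕ.* n` compute to a successor, the form of denominator in
-- `×1/≃`.
n²·1/n²≈1 n@(suc _) = pointwise-≈ λ i → trans (seq-· (n ℕ.* n) (1/n² n) i)
  (ℚ.toℚᵘ-injective (ℚᵘ.≃-trans (×1/≃ (n ℕ.* n) _)
    (*≡* (ℤ.*-comm (+ (n ℕ.* n)) (+ 1)))))

-- Sums and maxima

sum-mono-≤ : ∀ {n} {f g : Vector ℝ n} → (∀ i → f i ≤ g i) → sum f ≤ sum g
sum-mono-≤ {zero}  f≤g = ≤-refl
sum-mono-≤ {suc n} f≤g = +-mono-≤ (f≤g zero) (sum-mono-≤ (λ i → f≤g (suc i)))

sum-nonNegative : ∀ {n} {f : Vector ℝ n} → (∀ i → 0ℝ ≤ f i) → 0ℝ ≤ sum f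
sum-nonNegative {zero}  0≤f = ≤-refl
sum-nonNegative {suc n} 0≤f = ≤-trans (≈⇒≤ (≈-sym (+-identityʳ 0ℝ)))
  (+-mono-≤ (0≤f zero) (sum-nonNegative (λ i → 0≤f (suc i))))

sum-cong-≈ : ∀ {n} {f g : Vector ℝ n} → (∀ i → f i ≈ g i) → sum f ≈ sum g
sum-cong-≈ {f = f} {g} = sum-cong-≋ {x = f} {g}

-- A multiple is the sum of a constant vector, so this is an exchange of two finite sums.
·-distribˡ-sum : ∀ k {n} (f : Vector ℝ n) → k · sum f ≈ sum (λ i → k · f i)
·-distribˡ-sum k f = begin-equality
  k · sum f                           ≈⟨ sum-replicate k ⟨
  sum (replicate k (sum f))           ≈⟨ ∑-comm {k} (λ _ → f) ⟩
  sum (λ i → sum (replicate k (f i))) ≈⟨ sum-cong-≈ (λ i → sum-replicate k {f i}) ⟩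
  sum (λ i → k · f i)                 ∎

·-distribʳ-sum : ∀ {n} (f : Vector ℕ n) x → sumℕ f · x ≈ sum (λ i → f i · x)
·-distribʳ-sum {zero}  f x = ≈-refl
·-distribʳ-sum {suc n} f x = ≈-trans (·-homo-+ x (f zero) _)
  (+-congˡ (·-distribʳ-sum (λ i → f (suc i)) x))

x≤x⊔y : ∀ x y → x ≤ x ⊔ y
x≤x⊔y x y = pointwise-≤ λ i → ℚ.p≤p⊔q (seq x i) (seq y i)

y≤x⊔y : ∀ x y → y ≤ x ⊔ y
y≤x⊔y x y = pointwise-≤ λ i → ℚ.p≤q⊔p (seq x i) (seq y i)

-- The hypotheses hold only eventually and up to slack, so the argument goes through `⊔-<+`, with z
-- written as the maximum of z and itself.
⊔-lub : ∀ {x y z} → x ≤ z → y ≤ z → x ⊔ y ≤ z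
⊔-lub {x} {y} {z} (mk≤ p) (mk≤ q) = mk≤ λ ε 0<ε →
  let M , f = p ε 0<ε
      N , g = q ε 0<ε
  in M ℕ.⊔ N , λ i M⊔N≤i →
    subst (λ c → seq x i ℚ.⊔ seq y i ℚ.< c ℚ.+ ε) (ℚ.⊔-idem (seq z i))
      (⊔-<+ (seq x i) (seq y i) (seq z i) (seq z i)
        (f i (ℕ.m⊔n≤o⇒m≤o M N M⊔N≤i)) (g i (ℕ.m⊔n≤o⇒n≤o M N M⊔N≤i)))

≤-foldr-⊔-base : ∀ {k} x (t : Vector ℝ k) → x ≤ foldr _⊔_ x t
≤-foldr-⊔-base {zero}  x t = ≤-refl
≤-foldr-⊔-base {suc k} x t = ≤-trans (≤-foldr-⊔-base x (tail t)) (y≤x⊔y (head t) _)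

≤-foldr-⊔ : ∀ {k} x (t : Vector ℝ k) i → t i ≤ foldr _⊔_ x t
≤-foldr-⊔ x t zero    = x≤x⊔y (head t) _
≤-foldr-⊔ x t (suc i) = ≤-trans (≤-foldr-⊔ x (tail t) i) (y≤x⊔y (head t) _)

foldr-⊔-lub : ∀ {k x z} (t : Vector ℝ k) → x ≤ z → (∀ i → t i ≤ z) → foldr _⊔_ x t ≤ z
foldr-⊔-lub {zero}  t x≤z t≤z = x≤z
foldr-⊔-lub {suc k} t x≤z t≤z =
  ⊔-lub (t≤z zero) (foldr-⊔-lub (tail t) x≤z (λ i → t≤z (suc i)))

≤-maximum : ∀ {m} .{{_ : NonZero m}} (v : Vector ℝ m) i → v i ≤ maximum v
≤-maximum {suc m} v zero    = ≤-foldr-⊔-base (head v) (tail v)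
≤-maximum {suc m} v (suc i) = ≤-foldr-⊔ (head v) (tail v) i

maximum-lub : ∀ {m} .{{_ : NonZero m}} (v : Vector ℝ m) {z} → (∀ i → v i ≤ z) → maximum v ≤ z
maximum-lub {suc m} v v≤z = foldr-⊔-lub (tail v) (v≤z zero) (λ i → v≤z (suc i))

maximum-nonNegative : ∀ {m} .{{_ : NonZero m}} (v : Vector ℝ m) → (∀ i → 0ℝ ≤ v i) → 0ℝ ≤ maximum v
maximum-nonNegative {suc m} v 0≤v = ≤-trans (0≤v zero) (≤-maximum v zero)

-- Sums of natural numbers

≤-sumℕ : ∀ {n} (f : Vector ℕ n) i → f i ℕ.≤ sumℕ f
≤-sumℕ f zero    = ℕ.m≤m+n (f zero) _
≤-sumℕ f (suc i) = ℕ.≤-trans (≤-sumℕ (tail f) i) (ℕ.m≤n+m _ (f zero))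

sumℕ-ones : ∀ n → sumℕ (replicate n 1) ≡ n
sumℕ-ones zero    = refl
sumℕ-ones (suc n) = cong suc (sumℕ-ones n)

-- Translates the counting axioms of the plane into row and column sums: the summands have the form
-- of the entries of `incidenceMatrix`.
count-tabulate : ∀ {n} {A : Set} {P : Pred A 0ℓ} (P? : Decidable P) (f : Vector A n) →
  count P? (tabulate f) ≡
  sumℕ (λ i → toℕ {2} (if does (P? (f i)) then suc zero else zero))
count-tabulate {zero}  P? f = refl
count-tabulate {suc n} P? f with does (P? (f zero))
... | true  = cong suc (count-tabulate P? (tail f))
... | false = count-tabulate P? (tail f)

-- Storage limits

columnSum : ∀ {m x} → BinaryMatrix m x → Vector ℕ x
columnSum D j = sumℕ (λ i → toℕ (D i j))

storageLimit-nonNegative : ∀ {m x} .{{_ : NonZero m}} (D : BinaryMatrix m x) (s : Vector ℝ x) →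
  (∀ j → 0ℝ ≤ s j) → 0ℝ ≤ storageLimit D s
storageLimit-nonNegative D s 0≤s = maximum-nonNegative (D *ᵥ s) λ i →
  sum-nonNegative λ j → ·-nonNegative (toℕ (D i j)) (0≤s j)

-- Double counting: in the sum of the loads weighted by w, the share of group k occurs at least c
-- times, while each load is at most the storage limit.
weightedBound : ∀ {m x} .{{_ : NonZero m}} {D : BinaryMatrix m x} {s : Vector ℝ x} →
  IsDataDistribution D s → ∀ (w : Vector ℕ m) c →
  (∀ k → c ℕ.≤ sumℕ (λ i → w i ℕ.* toℕ (D i k))) →
  c · 1ℝ ≤ sumℕ w · storageLimit D s
weightedBound {D = D} {s} dist w c c≤ = begin
  c · 1ℝ
    ≈⟨ ·-congʳ c (≈-sym s-total) ⟩
  c · sum s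
    ≈⟨ ·-distribˡ-sum c s ⟩
  sum (λ k → c · s k)
    ≤⟨ sum-mono-≤ (λ k → ·-monoˡ-≤ (s-nonNegative k) (c≤ k)) ⟩
  sum (λ k → sumℕ (λ i → w i ℕ.* toℕ (D i k)) · s k)
    ≈⟨ sum-cong-≈ (λ k → ·-distribʳ-sum (λ i → w i ℕ.* toℕ (D i k)) (s k)) ⟩
  sum (λ k → sum (λ i → (w i ℕ.* toℕ (D i k)) · s k))
    -- From here on the total is grouped by machines instead of by data groups.
    ≈⟨ ∑-comm (λ k i → (w i ℕ.* toℕ (D i k)) · s k) ⟩
  sum (λ i → sum (λ k → (w i ℕ.* toℕ (D i k)) · s k))
    ≈⟨ sum-cong-≈ (λ i → sum-cong-≈ (λ k → ·-assocˡ (s k) (w i) (toℕ (D i k)))) ⟨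
  sum (λ i → sum (λ k → w i · (toℕ (D i k) · s k)))
    ≈⟨ sum-cong-≈ (λ i → ·-distribˡ-sum (w i) (λ k → toℕ (D i k) · s k)) ⟨
  sum (λ i → w i · (D *ᵥ s) i)
    ≤⟨ sum-mono-≤ (λ i → ·-monoʳ-≤ (w i) (≤-maximum (D *ᵥ s) i)) ⟩
  sum (λ i → w i · storageLimit D s)
    ≈⟨ ·-distribʳ-sum w (storageLimit D s) ⟨
  sumℕ w · storageLimit D s
    ∎
  where open IsDataDistribution dist

storageLimit-lowerBound : ∀ n .{{_ : NonZero n}} .{{_ : NonZero (n ℕ.* n ℕ.+ n)}}
  {x} (D : BinaryMatrix (n ℕ.* n ℕ.+ n) x) (s : Vector ℝ x) → IsATAC D s →
  n · 1/n² n ≤ storageLimit D s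
storageLimit-lowerBound n D s atac with any? (λ j → columnSum D j ℕ.≤? n)
... | yes (j , |j|≤n) = ·-cancelˡ-≤ n (begin
  n · (n · 1/n² n)                 ≈⟨ ·-assocˡ (1/n² n) n n ⟩
  (n ℕ.* n) · 1/n² n               ≈⟨ n²·1/n²≈1 n ⟩
  1ℝ                               ≈⟨ ·-homo-1 1ℝ ⟨
  1 · 1ℝ                           ≤⟨ weightedBound isDataDistribution column 1 covered ⟩
  columnSum D j · storageLimit D s ≤⟨ ·-monoˡ-≤ 0≤L |j|≤n ⟩
  n · storageLimit D s             ∎)
  where
  open IsATAC atac
  open IsDataDistribution isDataDistribution
  0≤L = storageLimit-nonNegative D s s-nonNegative
  column = λ i → toℕ (D i j)
  -- With column j as weights, the weighted sum at k is the entry `(D ᵀ* D) j k`, the number of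
  -- machines holding both j and k; all-to-all comparison makes it at least 1.
  covered = λ k → ℕ.n≢0⇒n>0 (allToAll j k)
-- The factor m is chosen because m · n = (n + 1) · n², which turns the left side into n + 1.
... | no ∄j = ·-cancelˡ-≤ m (begin
  m · (n · 1/n² n)                        ≈⟨ ·-assocˡ (1/n² n) m n ⟩
  (m ℕ.* n) · 1/n² n                      ≈⟨ ·-congˡ (rearrange n) ⟩
  (suc n ℕ.* (n ℕ.* n)) · 1/n² n          ≈⟨ ·-assocˡ (1/n² n) (suc n) (n ℕ.* n) ⟨
  suc n · ((n ℕ.* n) · 1/n² n)            ≈⟨ ·-congʳ (suc n) (n²·1/n²≈1 n) ⟩
  suc n · 1ℝ                              ≤⟨ weightedBound isDataDistribution (replicate m 1) (suc n) n<columnSum ⟩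
  sumℕ (replicate m 1) · storageLimit D s ≈⟨ ·-congˡ (sumℕ-ones m) ⟩
  m · storageLimit D s                    ∎)
  where
  open IsATAC atac
  m = n ℕ.* n ℕ.+ n
  rearrange : ∀ n → (n ℕ.* n ℕ.+ n) ℕ.* n ≡ suc n ℕ.* (n ℕ.* n)
  rearrange = solve-∀
  n<columnSum : ∀ k → n ℕ.< sumℕ (λ i → 1 ℕ.* toℕ (D i k))
  n<columnSum k = subst (n ℕ.<_) (Sumℕ.sum-cong-≗ (λ i → sym (ℕ.*-identityˡ (toℕ (D i k)))))
    (ℕ.≰⇒> (λ |k|≤n → ∄j (k , |k|≤n)))

-- The incidence matrix of an affine plane

module _ {n : ℕ} (P : AffinePlane n) where
  open AffinePlane P

  private
    D = incidenceMatrix P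

  incident⇒≡1 : ∀ {l p} → l ∋ p → toℕ (D l p) ≡ 1
  incident⇒≡1 {l} {p} l∋p rewrite dec-true (l ∋? p) l∋p = refl

  incidenceMatrix-allToAll : ∀ p q → (D ᵀ* D) p q ≢ 0
  incidenceMatrix-allToAll p q DᵀD≡0 with p ≟ q
  -- On the diagonal the entry counts the lines through p, of which there are n + 1.
  ... | yes refl = contradiction (trans (sym |p|≡1+n) DᵀD≡0) λ ()
    where
    idempotent : (b : Fin 2) → toℕ b ℕ.* toℕ b ≡ toℕ b
    idempotent zero       = refl
    idempotent (suc zero) = refl
    |p|≡1+n : (D ᵀ* D) p p ≡ suc n
    |p|≡1+n = trans (Sumℕ.sum-cong-≗ (λ l → idempotent (D l p)))
      (trans (sym (count-tabulate (λ l → l ∋? p) (λ l → l))) (lines-per-point p))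
  -- Off the diagonal the line joining p and q already contributes 1 to the sum.
  ... | no p≢q = contradiction
    (subst₂ ℕ._≤_ term≡1 DᵀD≡0 (≤-sumℕ (λ l → toℕ (D l p) ℕ.* toℕ (D l q)) pq)) λ ()
    where
    pq = proj₁ (unique-line p q p≢q)
    term≡1 : toℕ (D pq p) ℕ.* toℕ (D pq q) ≡ 1
    term≡1 = let l∋p , l∋q = proj₁ (proj₂ (unique-line p q p≢q)) in
      cong₂ ℕ._*_ (incident⇒≡1 l∋p) (incident⇒≡1 l∋q)

  -- Each line has n points, so equal shares load all machines equally.
  incidenceMatrix-load : ∀ q l → (D *ᵥ replicate (n ℕ.* n) q) l ≈ n · q
  incidenceMatrix-load q l = begin-equality
    sum (λ p → toℕ (D l p) · q)   ≈⟨ ·-distribʳ-sum (λ p → toℕ (D l p)) q ⟨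
    sumℕ (λ p → toℕ (D l p)) · q  ≈⟨ ·-congˡ rowSum≡n ⟩
    n · q                         ∎
    where
    rowSum≡n : sumℕ (λ p → toℕ (D l p)) ≡ n
    rowSum≡n = trans (sym (count-tabulate (l ∋?_) (λ p → p))) (points-per-line l)

0≤1/n² : ∀ n .{{_ : NonZero n}} → 0ℝ ≤ 1/n² n
0≤1/n² n = pointwise-≤ λ _ → ℚ.nonNegative⁻¹ _ {{ℚ.normalize-nonNeg 1 (n ℕ.* n) {{n*n≢0 n}}}}

theorem10 : (n : ℕ) .{{_ : NonZero n}} (P : AffinePlane n) →
    let instance m≢0 = n*n+n≢0 n
        D = incidenceMatrix P
        s = replicate (n ℕ.* n) (1/n² n)
    in IsATAC D s × IsMinimalStorageLimit (n ℕ.* n ℕ.+ n) (storageLimit D s)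
theorem10 n P = atac , record
  { attained   = _ , D , s , atac , ≈-refl
  ; lowerBound = λ E t atacE → ≤-trans
      -- Every load of the plane is `n · 1/n² n`, exactly the quantity that bounds the storage limit
      -- of E from below.
      (maximum-lub (D *ᵥ s) (λ l → ≈⇒≤ (incidenceMatrix-load P (1/n² n) l)))
      (storageLimit-lowerBound n E t atacE)
  }
  where
  instance
    m≢0 = n*n+n≢0 n
  D = incidenceMatrix P
  s = replicate (n ℕ.* n) (1/n² n)
  atac : IsATAC D s
  atac = record
    { isDataDistribution = record
      { groups-nonZero = n*n≢0 n
      ; s-nonNegative  = λ _ → 0≤1/n² n
      ; s-total        = ≈-trans (sum-replicate (n ℕ.* n)) (n²·1/n²≈1 n)
      }
    ; allToAll = incidenceMatrix-allToAll P
    }
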